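{- Let $\Gamma$ be a finite set of formulas and $\phi$ a formula of the past-time temporal epistemic logic described in the context. If the sequent $\Gamma\vdash\phi$ is derivable in the proof system described in the context, then $\Gamma\models\phi$; that is, for every model and every point $(\pi,i)$ of it, if $(\pi,i)\models\bigwedge\Gamma$ then $(\pi,i)\models\phi$.
   Context: **Program model.** $\mathit{Tid}=\{1,\dots,n\}$ is a finite set of threads. A global state $s$ consists of a shared store $s.\sigma$ (a map from shared variables to values) and, for each thread $A$, a local component $s.\lambda_A$ (control location and local variables). There is a labelled transition relation $s\xrightarrow{A}s'$ ($A\in\mathit{Tid}$) satisfying locality: if $s\xrightarrow{A}s'$ then $s'.\lambda_B=s.\lambda_B$ for all $B\neq A$. A run is an infinite sequence $\pi=s_0s_1s_2\cdots$ such that for each $i\ge 0$ there is a unique thread $\mathsf{act}(i)$ (depending on $\pi$) with $s_i\xrightarrow{\mathsf{act}(i)}s_{i+1}$. A point is a pair $(\pi,i)$, $i\ge 0$. **Indistinguishability.** $\mathsf{obs}_A(s)=s.\lambda_A$. If $k_1<\cdots<k_m$ are the indices $k<i$ with $\mathsf{act}(k)=A$, then $\mathsf{Hist}_A(\pi,i)=\langle \mathsf{obs}_A(s_0),\mathsf{obs}_A(s_{k_1+1}),\dots,\mathsf{obs}_A(s_{k_m+1}),\mathsf{obs}_A(s_i)\rangle$. Put $(\pi,i)\sim_A(\pi',i')$ iff $\mathsf{Hist}_A(\pi,i)=\mathsf{Hist}_A(\pi',i')$. A model is the set of runs of such a transition system, together with the relations $\sim_A$. **Syntax.** $\phi,\psi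 ::= p \mid A\ \mathsf{act}\mid\neg\phi\mid\phi\wedge\psi\mid\mathbf{Prev}\,\phi\mid\phi\,\mathbf{Since}\,\psi\mid\mathbf{K}_A\phi$, where $p$ ranges over atomic predicates of global states and $A\in\mathit{Tid}$; $\vee,\rightarrow,\leftrightarrow,\top$ are the usual abbreviations. **Semantics.** $(\pi,i)\models p$ iff $p$ holds of $s_i$; $(\pi,i)\models A\ \mathsf{act}$ iff $\mathsf{act}(i)=A$; Boolean connectives are as usual; $(\pi,i)\models\mathbf{Prev}\,\phi$ iff $i>0$ and $(\pi,i-1)\models\phi$; $(\pi,i)\models\phi\,\mathbf{Since}\,\psi$ iff there is $j$ with $0\le j\le i$, $(\pi,j)\models\psi$ and $(\pi,k)\models\phi$ for all $j<k\le i$; $(\pi,i)\models\mathbf{K}_A\phi$ iff $(\pi',i')\models\phi$ for all points $(\pi',i')$ of the model with $(\pi,i)\sim_A(\pi',i')$. **Proof system.** Sequents are $\Gamma\vdash\phi$ with $\Gamma$ a finite set of formulas. Write $\mathbf{Prev}\,\Gamma=\{\mathbf{Prev}\,\psi\mid\psi\in\Gamma\}$ and $\mathbf{K}_A\Gamma=\{\mathbf{K}_A\psi\mid\psi\in\Gamma\}$. The rules are: - A standard sound sequent-style system for classical propositional logic, including: from $\Gamma\vdash\phi$ and $\Gamma\vdash\phi\rightarrow\psi$ infer $\Gamma\vdash\psi$; from $\Gamma,\phi\vdash\psi$ and $\Gamma,\neg\phi\vdash\psi$ infer $\Gamma\vdash\psi$; and the usual introduction/elimination rules for $\wedge$ and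 $\vee$. - (prev) from $\Gamma\vdash\phi$ infer $\mathbf{Prev}\,\Gamma\vdash\mathbf{Prev}\,\top\rightarrow\mathbf{Prev}\,\phi$. - (sinceI$_1$) from $\Gamma\vdash\psi$ infer $\Gamma\vdash\phi\,\mathbf{Since}\,\psi$. - (sinceI$_2$) from $\Gamma\vdash\phi$ and $\Gamma\vdash\mathbf{Prev}(\phi\,\mathbf{Since}\,\psi)$ infer $\Gamma\vdash\phi\,\mathbf{Since}\,\psi$. - (sinceE) from $\Gamma\vdash\phi\,\mathbf{Since}\,\psi$, $\;\Gamma,\psi\vdash\chi$, and $\Gamma,\mathbf{Prev}(\phi\,\mathbf{Since}\,\psi),\phi\vdash\chi$ infer $\Gamma\vdash\chi$. - (sinceInd) from $\Gamma\vdash\psi\rightarrow\chi$ and $\Gamma\vdash(\phi\wedge\mathbf{Prev}\,\chi)\rightarrow\chi$ infer $\Gamma\vdash(\phi\,\mathbf{Since}\,\psi)\rightarrow\chi$, with the side condition that every formula in $\Gamma$ is past-hereditary, i.e. holds at a point only if it holds at all earlier points of the same run. - (K) from $\Gamma\vdash\phi$ infer $\mathbf{K}_A\Gamma\vdash\mathbf{K}_A\phi$. - (T) from $\Gamma\vdash\mathbf{K}_A\phi$ infer $\Gamma\vdash\phi$. - (4) from $\Gamma\vdash\mathbf{K}_A\phi$ infer $\Gamma\vdash\mathbf{K}_A\mathbf{K}_A\phi$. - (5) from $\Gamma\vdash\neg\mathbf{K}_A\phi$ infer $\Gamma\vdash\mathbf{K}_A\neg\mathbf{K}_A\phi$. 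-}

module Defs where

open import Data.Fin using (Fin; fromℕ<; _≟_)
open import Data.List using (List; []; _∷_; [_]; _++_; map; filter; upTo; foldr)
open import Data.List.Membership.Propositional using (_∈_)
open import Data.List.Relation.Binary.Subset.Propositional using (_⊆_)
open import Data.List.Relation.Unary.All using (All)
open import Data.Nat using (ℕ; suc; _∸_; _≤_; _<_; _>_; NonZero; >-nonZero⁻¹)
open import Data.Product using (Σ-syntax; ∃!; _×_; proj₁)
open import Relation.Binary.PropositionalEquality using (_≡_; _≢_)
open import Relation.Nullary using (¬_)

module Logic (n : ℕ) .{{_ : NonZero n}} (Atom : Set) where

  Tid : Set
  Tid = Fin n

  infix  9 _act
  infix  8 `¬_
  infixr 7 _`∧_
  infixr 6 _`∨_
  infix  6 _Since_
  infixr 5 _`→_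
  infix  4 _`↔_

  data Formula : Set where
    atom    : Atom → Formula
    _act    : Tid → Formula
    `¬_     : Formula → Formula
    _`∧_    : Formula → Formula → Formula
    Prev    : Formula → Formula
    _Since_ : Formula → Formula → Formula
    K       : Tid → Formula → Formula

  _`∨_ _`→_ _`↔_ : Formula → Formula → Formula
  φ `∨ ψ = `¬ (`¬ φ `∧ `¬ ψ)
  φ `→ ψ = `¬ φ `∨ ψ
  φ `↔ ψ = (φ `→ ψ) `∧ (ψ `→ φ)

  -- `Atom` may be empty, so ⊤ is obtained as an excluded-middle instance
  -- for the activity of the first thread.
  `⊤ : Formula
  `⊤ = first act `∨ `¬ (first act)
    where
    first : Tid
    first = fromℕ< (>-nonZero⁻¹ n)

  ⋀ : List Formula → Formula
  ⋀ = foldr _`∧_ `⊤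

  record GlobalState (Var Val : Set) (Local : Tid → Set) : Set where
    field
      store : Var → Val
      local : (A : Tid) → Local A

  -- The model is determined by its transition system: its points are those
  -- of all runs of the system.
  record Model : Set₁ where
    field
      Var Val : Set
      Local   : Tid → Set

    State : Set
    State = GlobalState Var Val Local

    obs : (A : Tid) → State → Local A
    obs A s = GlobalState.local s A

    field
      _—[_]→_  : State → Tid → State → Set
      locality : ∀ {s A s′} → s —[ A ]→ s′ → ∀ B → B ≢ A → obs B s′ ≡ obs B s
      holds    : Atom → State → Set

    record Run : Set where
      field
        state : ℕ → State
        step  : ∀ i → ∃! _≡_ (λ A → state i —[ A ]→ state (suc i))

      actor : ℕ → Tid
      actor i = proj₁ (step i)

    open Run public

    Hist : (A : Tid) → Run → ℕ → List (Local A)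
    Hist A π i =
      obs A (state π 0)
        ∷ map (λ k → obs A (state π (suc k)))
              (filter (λ k → actor π k ≟ A) (upTo i))
        ++ [ obs A (state π i) ]

    Indist : Tid → Run → ℕ → Run → ℕ → Set
    Indist A π i π′ i′ = Hist A π i ≡ Hist A π′ i′

  infix 3 ⟨_,_,_⟩⊨_ _⊨_ _⊢_

  ⟨_,_,_⟩⊨_ : (M : Model) → Model.Run M → ℕ → Formula → Set
  ⟨ M , π , i ⟩⊨ atom p     = Model.holds M p (Model.state π i)
  ⟨ M , π , i ⟩⊨ A act      = Model.actor π i ≡ A
  ⟨ M , π , i ⟩⊨ `¬ φ       = ¬ (⟨ M , π , i ⟩⊨ φ)
  ⟨ M , π , i ⟩⊨ φ `∧ ψ     = (⟨ M , π , i ⟩⊨ φ) × (⟨ M , π , i ⟩⊨ ψ)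
  ⟨ M , π , i ⟩⊨ Prev φ     = (i > 0) × (⟨ M , π , i ∸ 1 ⟩⊨ φ)
  ⟨ M , π , i ⟩⊨ φ Since ψ  =
    Σ[ j ∈ ℕ ] (j ≤ i) × (⟨ M , π , j ⟩⊨ ψ) × (∀ k → j < k → k ≤ i → ⟨ M , π , k ⟩⊨ φ)
  ⟨ M , π , i ⟩⊨ K A φ      =
    ∀ π′ i′ → Model.Indist M A π i π′ i′ → ⟨ M , π′ , i′ ⟩⊨ φ

  _⊨_ : List Formula → Formula → Set₁
  Γ ⊨ φ = ∀ (M : Model) (π : Model.Run M) i → ⟨ M , π , i ⟩⊨ ⋀ Γ → ⟨ M , π , i ⟩⊨ φ

  PastHereditary : Formula → Set₁
  PastHereditary φ =
    ∀ (M : Model) (π : Model.Run M) i j → j < i → ⟨ M , π , i ⟩⊨ φ → ⟨ M , π , j ⟩⊨ φ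

  -- Finite sets of formulas are lists; `weaken` makes derivability depend
  -- only on the underlying set.
  data _⊢_ : List Formula → Formula → Set₁ where
    hyp      : ∀ {Γ φ} → φ ∈ Γ → Γ ⊢ φ
    weaken   : ∀ {Γ Δ φ} → Γ ⊆ Δ → Γ ⊢ φ → Δ ⊢ φ
    ¬I       : ∀ {Γ φ ψ} → φ ∷ Γ ⊢ ψ → φ ∷ Γ ⊢ `¬ ψ → Γ ⊢ `¬ φ
    ¬E       : ∀ {Γ φ ψ} → Γ ⊢ φ → Γ ⊢ `¬ φ → Γ ⊢ ψ
    cases    : ∀ {Γ φ ψ} → φ ∷ Γ ⊢ ψ → `¬ φ ∷ Γ ⊢ ψ → Γ ⊢ ψ
    ∧I       : ∀ {Γ φ ψ} → Γ ⊢ φ → Γ ⊢ ψ → Γ ⊢ φ `∧ ψ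
    ∧E₁      : ∀ {Γ φ ψ} → Γ ⊢ φ `∧ ψ → Γ ⊢ φ
    ∧E₂      : ∀ {Γ φ ψ} → Γ ⊢ φ `∧ ψ → Γ ⊢ ψ
    ∨I₁      : ∀ {Γ φ ψ} → Γ ⊢ φ → Γ ⊢ φ `∨ ψ
    ∨I₂      : ∀ {Γ φ ψ} → Γ ⊢ ψ → Γ ⊢ φ `∨ ψ
    ∨E       : ∀ {Γ φ ψ χ} → Γ ⊢ φ `∨ ψ → φ ∷ Γ ⊢ χ → ψ ∷ Γ ⊢ χ → Γ ⊢ χ
    →I       : ∀ {Γ φ ψ} → φ ∷ Γ ⊢ ψ → Γ ⊢ φ `→ ψ
    →E       : ∀ {Γ φ ψ} → Γ ⊢ φ → Γ ⊢ φ `→ ψ → Γ ⊢ ψ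
    prev     : ∀ {Γ φ} → Γ ⊢ φ → map Prev Γ ⊢ Prev `⊤ `→ Prev φ
    sinceI₁  : ∀ {Γ φ ψ} → Γ ⊢ ψ → Γ ⊢ φ Since ψ
    sinceI₂  : ∀ {Γ φ ψ} → Γ ⊢ φ → Γ ⊢ Prev (φ Since ψ) → Γ ⊢ φ Since ψ
    sinceE   : ∀ {Γ φ ψ χ} → Γ ⊢ φ Since ψ → ψ ∷ Γ ⊢ χ →
               φ ∷ Prev (φ Since ψ) ∷ Γ ⊢ χ → Γ ⊢ χ
    sinceInd : ∀ {Γ φ ψ χ} → All PastHereditary Γ →
               Γ ⊢ ψ `→ χ → Γ ⊢ (φ `∧ Prev χ) `→ χ → Γ ⊢ φ Since ψ `→ χ
    ruleK    : ∀ {Γ A φ} → Γ ⊢ φ → map (K A) Γ ⊢ K A φ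
    ruleT    : ∀ {Γ A φ} → Γ ⊢ K A φ → Γ ⊢ φ
    rule4    : ∀ {Γ A φ} → Γ ⊢ K A φ → Γ ⊢ K A (K A φ)
    rule5    : ∀ {Γ A φ} → Γ ⊢ `¬ K A φ → Γ ⊢ K A (`¬ K A φ)

{-# OPTIONS --safe #-}
module Submission where

open import Axiom.DoubleNegationElimination using (em⇒dne)
open import Axiom.ExcludedMiddle using (ExcludedMiddle)
open import Data.List using (List; []; _∷_)
open import Data.List.Relation.Binary.Subset.Propositional.Properties using (All-resp-⊇)
open import Data.List.Relation.Unary.All as All using (All; []; _∷_; lookup)
open import Data.List.Relation.Unary.All.Properties using (map⁻)
open import Data.Nat using (ℕ; suc; _≤_; s≤s; s≤s⁻¹; z≤n; NonZero)
open import Data.Nat.Properties using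
  (≤-refl; n<1+n; <-irrefl; <-≤-trans; m≤n⇒m≤1+n; m≤n⇒m<n∨m≡n)
open import Data.Product using (_×_; _,_; proj₁; proj₂)
open import Data.Sum using (_⊎_; inj₁; inj₂)
open import Level using (0ℓ)
open import Relation.Binary.PropositionalEquality using (refl; sym; trans)
open import Relation.Nullary using (yes; no; contradiction)
open import Defs

-- Soundness is proved by induction on derivations, for all points at once, because `prev`,
-- `sinceInd` and `ruleK` use their premises at other points. The `Since` rules rest on the fixpoint
-- law: φ `Since` ψ holds now iff ψ holds now, or φ holds now and φ `Since` ψ held one step earlier.
-- The induction rule is then induction on time. The epistemic rules use only that equality of
-- histories is an equivalence relation: reflexivity gives T, transitivity gives 4, and with
-- symmetry 5. Excluded middle serves `cases` and the elimination of disjunction and implication,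
-- which are encoded by negation and conjunction.

module Soundness (em : ExcludedMiddle 0ℓ) (n : ℕ) .{{_ : NonZero n}} (Atom : Set) where
  open Logic n Atom

  module _ {M : Model} {π : Model.Run M} where

    infix 3 _⊨ᵖ_ _⊨ᴬ_

    _⊨ᵖ_ : ℕ → Formula → Set
    i ⊨ᵖ φ = ⟨ M , π , i ⟩⊨ φ

    _⊨ᴬ_ : ℕ → List Formula → Set
    i ⊨ᴬ Γ = All (i ⊨ᵖ_) Γ

    ⋀⇒All : ∀ {i} Γ → i ⊨ᵖ ⋀ Γ → i ⊨ᴬ Γ
    ⋀⇒All []      _       = []
    ⋀⇒All (φ ∷ Γ) (p , γ) = p ∷ ⋀⇒All Γ γ

    -- The formulas are explicit here and below because satisfaction computes by recursion on them,
    -- so unification cannot recover them from its result.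
    →-intro : ∀ {i} φ ψ → (i ⊨ᵖ φ → i ⊨ᵖ ψ) → i ⊨ᵖ φ `→ ψ
    →-intro φ ψ f (¬¬p , ¬q) = ¬¬p λ p → ¬q (f p)

    →-elim : ∀ {i} φ ψ → i ⊨ᵖ φ `→ ψ → i ⊨ᵖ φ → i ⊨ᵖ ψ
    →-elim φ ψ f p = em⇒dne em λ ¬q → f ((λ ¬p → ¬p p) , ¬q)

    ∨-elim : ∀ {i} φ ψ → i ⊨ᵖ φ `∨ ψ → (i ⊨ᵖ φ) ⊎ (i ⊨ᵖ ψ)
    ∨-elim φ ψ d = em⇒dne em λ ¬s → d ((λ p → ¬s (inj₁ p)) , λ q → ¬s (inj₂ q))

    since-now : ∀ {i} φ ψ → i ⊨ᵖ ψ → i ⊨ᵖ φ Since ψ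
    since-now {i} φ ψ q = i , ≤-refl , q , λ k i<k k≤i →
      contradiction (<-≤-trans i<k k≤i) (<-irrefl refl)

    since-step : ∀ {i} φ ψ → i ⊨ᵖ φ → i ⊨ᵖ Prev (φ Since ψ) → i ⊨ᵖ φ Since ψ
    since-step {suc i} φ ψ p (_ , j , j≤i , q , ps) = j , m≤n⇒m≤1+n j≤i , q , ps′
      where
      ps′ : ∀ k → _ → k ≤ suc i → k ⊨ᵖ φ
      ps′ k j<k k≤1+i with m≤n⇒m<n∨m≡n k≤1+i
      ... | inj₁ k<1+i = ps k j<k (s≤s⁻¹ k<1+i)
      ... | inj₂ refl  = p

    since-unfold : ∀ {i} φ ψ → i ⊨ᵖ φ Since ψ →
                   (i ⊨ᵖ ψ) ⊎ ((i ⊨ᵖ φ) × (i ⊨ᵖ Prev (φ Since ψ)))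
    since-unfold {i} φ ψ (j , j≤i , q , ps) with m≤n⇒m<n∨m≡n j≤i
    ... | inj₂ refl = inj₁ q
    -- A witness strictly before `i` makes `i` a successor, so `i ∸ 1` reduces to `i′` and the same
    -- `j` still serves there.
    ... | inj₁ (s≤s {n = i′} j≤i′) = inj₂
      ( ps i (s≤s j≤i′) ≤-refl
      , s≤s z≤n , j , j≤i′ , q , λ k j<k k≤i′ → ps k j<k (m≤n⇒m≤1+n k≤i′))

    -- Unfolding `Since` either ends at ψ or moves one instant back, so induction on time applies.
    -- Past-heredity keeps Γ true at the earlier instant, where the induction hypothesis needs it.
    since-ind : ∀ {Γ} φ ψ χ → All PastHereditary Γ →
                (∀ i → i ⊨ᴬ Γ → i ⊨ᵖ ψ → i ⊨ᵖ χ) →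
                (∀ i → i ⊨ᴬ Γ → i ⊨ᵖ φ `∧ Prev χ → i ⊨ᵖ χ) →
                ∀ i → i ⊨ᴬ Γ → i ⊨ᵖ φ Since ψ → i ⊨ᵖ χ
    since-ind φ ψ χ her base next i γ s with since-unfold φ ψ s
    ... | inj₁ q = base i γ q
    -- Instant 0 cannot occur here, since `Prev` demands `i > 0`.
    since-ind φ ψ χ her base next (suc i) γ s | inj₂ (p , i>0 , s′) =
      next (suc i) γ (p , i>0 , since-ind φ ψ χ her base next i γ′ s′)
      where
      γ′ : i ⊨ᴬ _
      γ′ = All.zipWith (λ (h , r) → h M π (suc i) i (n<1+n i) r) (her , γ)

  sound : ∀ {Γ φ} → Γ ⊢ φ → ∀ M (π : Model.Run M) i →
          All (⟨ M , π , i ⟩⊨_) Γ → ⟨ M , π , i ⟩⊨ φ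
  sound (hyp φ∈Γ) M π i γ = lookup γ φ∈Γ
  sound (weaken Γ⊆Δ d) M π i γ = sound d M π i (All-resp-⊇ Γ⊆Δ γ)
  sound (¬I d e) M π i γ p = sound e M π i (p ∷ γ) (sound d M π i (p ∷ γ))
  sound (¬E d e) M π i γ = contradiction (sound d M π i γ) (sound e M π i γ)
  sound (cases {φ = φ} d e) M π i γ with em {P = ⟨ M , π , i ⟩⊨ φ}
  ... | yes p = sound d M π i (p ∷ γ)
  ... | no ¬p = sound e M π i (¬p ∷ γ)
  sound (∧I d e) M π i γ = sound d M π i γ , sound e M π i γ
  sound (∧E₁ d) M π i γ = proj₁ (sound d M π i γ)
  sound (∧E₂ d) M π i γ = proj₂ (sound d M π i γ)
  sound (∨I₁ d) M π i γ (¬p , _) = ¬p (sound d M π i γ)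
  sound (∨I₂ d) M π i γ (_ , ¬q) = ¬q (sound d M π i γ)
  sound (∨E {φ = φ} {ψ} d e f) M π i γ with ∨-elim φ ψ (sound d M π i γ)
  ... | inj₁ p = sound e M π i (p ∷ γ)
  ... | inj₂ q = sound f M π i (q ∷ γ)
  sound (→I {φ = φ} {ψ} d) M π i γ = →-intro φ ψ λ p → sound d M π i (p ∷ γ)
  sound (→E {φ = φ} {ψ} d e) M π i γ = →-elim φ ψ (sound e M π i γ) (sound d M π i γ)
  -- `Prev` of `⊤` supplies `i > 0`, which the hypotheses cannot do when Γ is empty.
  sound (prev {φ = φ} d) M π i γ = →-intro (Prev `⊤) (Prev φ) λ (i>0 , _) →
    i>0 , sound d M π _ (All.map proj₂ (map⁻ γ))
  sound (sinceI₁ {φ = φ} {ψ} d) M π i γ = since-now φ ψ (sound d M π i γ)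
  sound (sinceI₂ {φ = φ} {ψ} d e) M π i γ =
    since-step φ ψ (sound d M π i γ) (sound e M π i γ)
  sound (sinceE {φ = φ} {ψ} d e f) M π i γ with since-unfold φ ψ (sound d M π i γ)
  ... | inj₁ q       = sound e M π i (q ∷ γ)
  ... | inj₂ (p , s) = sound f M π i (p ∷ s ∷ γ)
  sound (sinceInd {φ = φ} {ψ} {χ} her d e) M π i γ =
    →-intro (φ Since ψ) χ (since-ind φ ψ χ her
      -- Both premises are used at every instant `k` where Γ holds, not only at `i`.
      (λ k δ → →-elim ψ χ (sound d M π k δ))
      (λ k δ → →-elim (φ `∧ Prev χ) χ (sound e M π k δ)) i γ)
  sound (ruleK d) M π i γ π′ i′ ∼ = sound d M π′ i′ (All.map (λ k → k π′ i′ ∼) (map⁻ γ))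
  sound (ruleT d) M π i γ = sound d M π i γ π i refl
  sound (rule4 d) M π i γ π′ i′ ∼ π″ i″ ∼′ = sound d M π i γ π″ i″ (trans ∼ ∼′)
  -- Knowledge `k` at the second point would transfer back to the first, where it is refuted.
  sound (rule5 d) M π i γ π′ i′ ∼ k = sound d M π i γ λ π″ i″ ∼′ → k π″ i″ (trans (sym ∼) ∼′)

theorem1 : ExcludedMiddle 0ℓ →
    (n : ℕ) .{{_ : NonZero n}} (Atom : Set) → let open Logic n Atom in
    (Γ : List Formula) (φ : Formula) → Γ ⊢ φ → Γ ⊨ φ
theorem1 em n Atom Γ φ d M π i γ = sound d M π i (⋀⇒All Γ γ)
  where open Soundness em n Atom
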